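{- Let $C_{(=,\geq)}(x,y)$ be the bivariate generating function of the Catalan words avoiding the ordered pair of relations $(=,\geq)$, where $x$ marks the length and $y$ marks the number of descents. Then $$C_{(=,\geq)}(x,y)=\frac{1 - x - x^2 + 2 x y - \sqrt{(1 - x - x^2 + 2 x y)^2 - 4 x y (1 + x y)}}{2xy}.$$
   Context: A Catalan word of length $n$ is a word $w=w_1w_2\cdots w_n$ over the non-negative integers with $w_1=0$ and $0\leq w_i\leq w_{i-1}+1$ for $i=2,\dots,n$; the empty word is the unique Catalan word of length $0$. For relations $X,Y\in\{<,>,\leq,\geq,=,\neq\}$, a word $w$ contains the pattern $(X,Y)$ if there is an index $i\geq 1$ (with $i+2\le n$) such that $w_i\,X\,w_{i+1}$ and $w_{i+1}\,Y\,w_{i+2}$; otherwise $w$ avoids $(X,Y)$. The number of descents $\mathrm{des}(w)$ is the number of indices $i$ with $w_i>w_{i+1}$. The bivariate generating function is $C_{(X,Y)}(x,y)=\sum_{w}x^{|w|}y^{\mathrm{des}(w)}$, the sum being over all Catalan words $w$ (of any length $|w|\geq 0$) avoiding $(X,Y)$. Identities are between formal power series in $x$ with coefficients polynomials in $y$ (after clearing denominators); the square root of a power series with constant term $1$ is the one with constant term $1$. -}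

module Defs where

open import Algebra.Bundles using (RawRing)
import Algebra.Definitions.RawSemiring as RawSemiringDefs
open import Data.Bool.Base using (if_then_else_)
open import Data.Fin.Base using (toℕ)
open import Data.Integer.Base using (ℤ)
import Data.Integer.Base as ℤ
open import Data.List.Base using (List; []; _∷_; length; map; filter; foldr; concatMap; upTo)
open import Data.List.Membership.Propositional using (_∈_; find; lose)
open import Data.List.Membership.Propositional.Properties using (∈-map⁺; ∈-map⁻; ∈-concatMap⁺; ∈-concatMap⁻; ∈-upTo⁺; ∈-upTo⁻)
open import Data.List.Properties using (∷-injectiveˡ; ∷-injectiveʳ)
open import Data.List.Relation.Unary.All as All using ()
import Data.List.Relation.Unary.All.Properties as All
open import Data.List.Relation.Unary.AllPairs as AllPairs using ([]; _∷_)
import Data.List.Relation.Unary.AllPairs.Properties as AllPairs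
open import Data.List.Relation.Unary.Any using (here; there)
open import Data.List.Relation.Unary.Linked using (Linked; []; [-]; _∷_)
open import Data.List.Relation.Unary.Unique.Propositional using (Unique)
import Data.List.Relation.Unary.Unique.Propositional.Properties as Unique
open import Data.Nat.Base using (ℕ; zero; suc; _∸_; _≤_; s≤s; s≤s⁻¹)
import Data.Nat.Base as ℕ
open import Data.Nat.Properties using (_>?_; suc-injective)
open import Data.Product.Base using (_×_; _,_)
open import Data.Sum.Base using (inj₁; inj₂; [_,_]′)
open import Level using (0ℓ; _⊔_)
open import Relation.Binary.Core using (Rel)
open import Relation.Binary.Definitions using (Decidable)
open import Relation.Binary.PropositionalEquality using (_≡_; _≢_; refl; sym; trans; cong)
open import Relation.Nullary.Decidable using (no; does; ¬?; _×-dec_; _⊎-dec_; map′)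
open import Relation.Nullary.Negation using (¬_)
open import Relation.Unary using (Pred)
import Relation.Unary as U

-- Univariate polynomials: coefficient lists, constant term first.  Lists
-- differing by trailing zeros are identified by _≈ₚ_.

module Polynomial {c ℓ} (R : RawRing c ℓ) where

  open RawRing R

  Poly : Set c
  Poly = List Carrier

  coeff : Poly → ℕ → Carrier
  coeff []      _       = 0#
  coeff (a ∷ _) zero    = a
  coeff (_ ∷ p) (suc n) = coeff p n

  infix  4 _≈ₚ_
  infixl 6 _+ₚ_
  infixl 7 _*ₚ_

  _≈ₚ_ : Rel Poly ℓ
  p ≈ₚ q = ∀ n → coeff p n ≈ coeff q n

  _+ₚ_ : Poly → Poly → Poly
  []      +ₚ q       = q
  (a ∷ p) +ₚ []      = a ∷ p
  (a ∷ p) +ₚ (b ∷ q) = a + b ∷ p +ₚ q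

  _*ₚ_ : Poly → Poly → Poly
  []      *ₚ _ = []
  (a ∷ p) *ₚ q = map (a *_) q +ₚ (0# ∷ p *ₚ q)

  polynomialRing : RawRing c ℓ
  polynomialRing = record
    { Carrier = Poly
    ; _≈_     = _≈ₚ_
    ; _+_     = _+ₚ_
    ; _*_     = _*ₚ_
    ; -_      = map (-_)
    ; 0#      = []
    ; 1#      = 1# ∷ []
    }

  indeterminate : Poly
  indeterminate = 0# ∷ 1# ∷ []

-- Univariate formal power series: f n is the coefficient of the n-th
-- power of the indeterminate.

module PowerSeries {c ℓ} (R : RawRing c ℓ) where

  open RawRing R
  open RawSemiringDefs rawSemiring using (sum)

  Series : Set c
  Series = ℕ → Carrier

  constant : Carrier → Series
  constant a zero    = a
  constant a (suc _) = 0#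

  indeterminate : Series
  indeterminate 1 = 1#
  indeterminate _ = 0#

  powerSeriesRing : RawRing c ℓ
  powerSeriesRing = record
    { Carrier = Series
    ; _≈_     = λ f g → ∀ n → f n ≈ g n
    ; _+_     = λ f g n → f n + g n
    ; _*_     = λ f g n → sum {suc n} (λ i → f (toℕ i) * g (n ∸ toℕ i))
    ; -_      = λ f n → - f n
    ; 0#      = constant 0#
    ; 1#      = constant 1#
    }

  record IsSqrt (f s : Series) : Set ℓ where
    private module S = RawRing powerSeriesRing
    field
      constantTerm : s 0 ≈ 1#
      square       : s S.* s S.≈ f

ℤ[y] : RawRing 0ℓ 0ℓ
ℤ[y] = Polynomial.polynomialRing ℤ.+-*-rawRing

ℤ[y]⟦x⟧ : RawRing 0ℓ 0ℓ
ℤ[y]⟦x⟧ = PowerSeries.powerSeriesRing ℤ[y]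

open PowerSeries ℤ[y] public using (Series; IsSqrt)

x : Series
x = PowerSeries.indeterminate ℤ[y]

y : Series
y = PowerSeries.constant ℤ[y] (Polynomial.indeterminate ℤ.+-*-rawRing)

open RawRing ℤ[y]⟦x⟧ public using (_≈_; _+_; _*_; -_; 1#)

-- n · f is the n-fold sum f + ⋯ + f.
open RawSemiringDefs (RawRing.rawSemiring ℤ[y]⟦x⟧) public using (_^_) renaming (_×_ to _·_)

infixl 6 _-_

_-_ : Series → Series → Series
f - g = f + (- g)

data IsCatalan : List ℕ → Set where
  []  : IsCatalan []
  0∷_ : ∀ {w} → Linked (λ a b → b ≤ suc a) (0 ∷ w) → IsCatalan (0 ∷ w)

-- All u of length n such that, after a letter a, each letter of u exceeds
-- its predecessor by at most 1.
continuations : ℕ → ℕ → List (List ℕ)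
continuations a zero    = [] ∷ []
continuations a (suc n) = concatMap (λ b → map (b ∷_) (continuations b n)) (upTo (2 ℕ.+ a))

-- The Catalan words of length n, each listed once: see ∈-catalanWords⁺,
-- ∈-catalanWords⁻ and catalanWords-unique.
catalanWords : ℕ → List (List ℕ)
catalanWords zero    = [] ∷ []
catalanWords (suc n) = map (0 ∷_) (continuations 0 n)

module _ {ℓ₁ ℓ₂} (X : Rel ℕ ℓ₁) (Y : Rel ℕ ℓ₂) where

  data Contains : Pred (List ℕ) (ℓ₁ ⊔ ℓ₂) where
    here  : ∀ {a b c w} → X a b → Y b c → Contains (a ∷ b ∷ c ∷ w)
    there : ∀ {a w} → Contains w → Contains (a ∷ w)

  Avoids : Pred (List ℕ) (ℓ₁ ⊔ ℓ₂)
  Avoids w = ¬ Contains w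

module _ {ℓ₁ ℓ₂} {X : Rel ℕ ℓ₁} {Y : Rel ℕ ℓ₂} (X? : Decidable X) (Y? : Decidable Y) where

  contains? : U.Decidable (Contains X Y)
  contains? []          = no λ ()
  contains? (_ ∷ [])    = no λ { (there ()) }
  contains? (_ ∷ _ ∷ []) = no λ { (there (there ())) }
  contains? (a ∷ b ∷ c ∷ w) =
    map′ [ (λ (p , q) → here p q) , there ]′
         (λ { (here p q) → inj₁ (p , q) ; (there h) → inj₂ h })
         ((X? a b ×-dec Y? b c) ⊎-dec contains? (b ∷ c ∷ w))

  avoids? : U.Decidable (Avoids X Y)
  avoids? w = ¬? (contains? w)

des : List ℕ → ℕ
des []          = 0
des (_ ∷ [])    = 0
des (a ∷ b ∷ w) = (if does (a >? b) then 1 else 0) ℕ.+ des (b ∷ w)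

-- The generating function of the Catalan words avoiding (X , Y): the
-- coefficient of xⁿ is the sum of y ^ des w over such words w of length n.
C : ∀ {ℓ₁ ℓ₂} {X : Rel ℕ ℓ₁} {Y : Rel ℕ ℓ₂} → Decidable X → Decidable Y → Series
C X? Y? n = foldr _+ₚ_ 0ₚ (map (λ w → yₚ ^ₚ des w) (filter (avoids? X? Y?) (catalanWords n)))
  where
  open RawRing ℤ[y] using (rawSemiring) renaming (_+_ to _+ₚ_; 0# to 0ₚ)
  open RawSemiringDefs rawSemiring using () renaming (_^_ to _^ₚ_)
  yₚ = Polynomial.indeterminate ℤ.+-*-rawRing

private
  Steps : List ℕ → Set
  Steps = Linked (λ a b → b ≤ suc a)

  ∈-continuations⁺ : ∀ {a} w → Steps (a ∷ w) → w ∈ continuations a (length w)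
  ∈-continuations⁺ []      _        = here refl
  ∈-continuations⁺ (b ∷ w) (p ∷ ps) =
    ∈-concatMap⁺ (λ b → map (b ∷_) (continuations b (length w))) (lose (∈-upTo⁺ (s≤s p)) (∈-map⁺ (b ∷_) (∈-continuations⁺ w ps)))

  ∈-continuations⁻ : ∀ {a w} n → w ∈ continuations a n → Steps (a ∷ w) × length w ≡ n
  ∈-continuations⁻ zero    (here refl) = [-] , refl
  ∈-continuations⁻ {a} (suc n) w∈
    with b , b∈ , w∈′ ← find (∈-concatMap⁻ (λ b → map (b ∷_) (continuations b n)) {xs = upTo (2 ℕ.+ a)} w∈)
    with u , u∈ , refl ← ∈-map⁻ (b ∷_) w∈′
    with ps , eq ← ∈-continuations⁻ n u∈
    = s≤s⁻¹ (∈-upTo⁻ b∈) ∷ ps , cong suc eq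

  continuations-unique : ∀ a n → Unique (continuations a n)
  continuations-unique a zero    = All.[] ∷ []
  continuations-unique a (suc n) = Unique.concat⁺
    (All.map⁺ (All.universal (λ b → Unique.map⁺ ∷-injectiveʳ (continuations-unique b n)) _))
    (AllPairs.map⁺ (AllPairs.map disjoint (Unique.upTo⁺ (2 ℕ.+ a))))
    where
    disjoint : ∀ {b c} → b ≢ c → ∀ {w} →
      ¬ (w ∈ map (b ∷_) (continuations b n) × w ∈ map (c ∷_) (continuations c n))
    disjoint b≢c (w∈b , w∈c)
      with _ , _ , p ← ∈-map⁻ _ w∈b
      with _ , _ , q ← ∈-map⁻ _ w∈c
      = b≢c (∷-injectiveˡ (trans (sym p) q))

∈-catalanWords⁺ : ∀ {w} → IsCatalan w → w ∈ catalanWords (length w)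
∈-catalanWords⁺ []               = here refl
∈-catalanWords⁺ (0∷_ {w} steps) = ∈-map⁺ (0 ∷_) (∈-continuations⁺ w steps)

∈-catalanWords⁻ : ∀ {w} n → w ∈ catalanWords n → IsCatalan w × length w ≡ n
∈-catalanWords⁻ zero    (here refl) = [] , refl
∈-catalanWords⁻ (suc n) w∈
  with u , u∈ , refl ← ∈-map⁻ (0 ∷_) w∈
  with ps , eq ← ∈-continuations⁻ n u∈
  = 0∷ ps , cong suc eq

catalanWords-unique : ∀ n → Unique (catalanWords n)
catalanWords-unique zero    = All.[] ∷ []
catalanWords-unique (suc n) = Unique.map⁺ ∷-injectiveʳ (continuations-unique 0 n)

{-# OPTIONS --safe #-}
module Submission where

-- Let F a be the generating function of the words that can follow a letter a
-- which does not repeat its predecessor.  Reading one or two letters gives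
--   F a = 1 + x + (x + x²) F (a + 1) + x y (F 0 + ⋯ + F (a - 1)),
-- and the differences of consecutive equations form a homogeneous linear
-- recurrence with a unique solution for given F 0.  Hence F is a geometric
-- progression, so F 1 ² = F 0 · F 2; eliminating F 1 and F 2 leaves a quadratic
-- equation for F 0, and C = 1 + x F 0 satisfies
--   x y C² - (1 - x - x² + 2 x y) C + 1 + x y = 0.
-- Completing the square, P - 2 x y C is the square root of the discriminant.

open import Defs using (module Polynomial; module PowerSeries; continuations; catalanWords; avoids?; des)
open import Algebra.Bundles using (CommutativeRing; RawRing)
import Algebra.Definitions.RawSemiring as RawSemiringDefs
import Algebra.Morphism.RingMonomorphism as RingMonomorphism
open import Algebra.Morphism.Structures using (IsRingMonomorphism)
import Algebra.Properties.CommutativeSemigroup as CommutativeSemigroupProperties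
import Algebra.Properties.Ring as RingProperties
import Algebra.Solver.Ring.NaturalCoefficients.Default as NaturalSolver
open import Algebra.Structures using (IsCommutativeRing)
open import Data.Bool.Base using (if_then_else_; true; false)
import Data.Integer.Base as ℤ
import Data.Integer.Properties as ℤ
open import Data.List.Base using (List; []; _∷_; _++_; map; filter; foldr; concatMap; upTo)
open import Data.List.Properties using (upTo-∷ʳ)
open import Data.Nat.Base using (ℕ; zero; suc; _≤_; _<_; z≤n; s≤s)
open import Data.Nat.Properties using (_≟_; _≥?_; _>?_; ≤-refl; ≤-trans; m≤n⇒m≤1+n; <-irrefl; <⇒≢; <⇒≯;
  <⇒≱; >⇒≢; <⇒≤; m<n⇒m<1+n; n<1+n)
open import Data.Product.Base using (_×_; ∃; _,_)
open import Function.Base using (_∘_)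
open import Relation.Binary.PropositionalEquality as ≡ using (_≡_)
import Relation.Binary.Reasoning.Setoid as ≈-Reasoning
open import Relation.Nullary.Decidable using (does; dec-true; dec-false)
import Relation.Unary as U

-- Finite sums over lists.

module ListSum {c ℓ} (R : CommutativeRing c ℓ) where

  open CommutativeRing R
  open ≈-Reasoning setoid

  Σ : ∀ {a} {A : Set a} → (A → Carrier) → List A → Carrier
  Σ f xs = foldr _+_ 0# (map f xs)

  module _ {a} {A : Set a} where

    Σ-cong : {f g : A → Carrier} → (∀ x → f x ≈ g x) → ∀ xs → Σ f xs ≈ Σ g xs
    Σ-cong f≈g []       = refl
    Σ-cong f≈g (x ∷ xs) = +-cong (f≈g x) (Σ-cong f≈g xs)

    Σ-zero : {f : A → Carrier} → (∀ x → f x ≈ 0#) → ∀ xs → Σ f xs ≈ 0#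
    Σ-zero f≈0 []       = refl
    Σ-zero f≈0 (x ∷ xs) = trans (+-cong (f≈0 x) (Σ-zero f≈0 xs)) (+-identityˡ 0#)

    Σ-distribˡ : ∀ c (f : A → Carrier) xs → Σ (λ x → c * f x) xs ≈ c * Σ f xs
    Σ-distribˡ c f []       = sym (zeroʳ c)
    Σ-distribˡ c f (x ∷ xs) = trans (+-congˡ (Σ-distribˡ c f xs)) (sym (distribˡ c _ _))

    Σ-++ : ∀ (f : A → Carrier) xs ys → Σ f (xs ++ ys) ≈ Σ f xs + Σ f ys
    Σ-++ f []       ys = sym (+-identityˡ _)
    Σ-++ f (x ∷ xs) ys = trans (+-congˡ (Σ-++ f xs ys)) (sym (+-assoc _ _ _))

    Σ-filter : ∀ {p} {P : U.Pred A p} (P? : U.Decidable P) (f : A → Carrier) xs →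
               Σ f (filter P? xs) ≈ Σ (λ x → if does (P? x) then f x else 0#) xs
    Σ-filter P? f []       = refl
    Σ-filter P? f (x ∷ xs) with does (P? x)
    ... | true  = +-congˡ (Σ-filter P? f xs)
    ... | false = trans (Σ-filter P? f xs) (sym (+-identityˡ _))

  module _ {a b} {A : Set a} {B : Set b} where

    Σ-map : ∀ (f : B → Carrier) (g : A → B) xs → Σ f (map g xs) ≈ Σ (f ∘ g) xs
    Σ-map f g []       = refl
    Σ-map f g (x ∷ xs) = +-congˡ (Σ-map f g xs)

    Σ-concatMap : ∀ (f : B → Carrier) (g : A → List B) xs →
                  Σ f (concatMap g xs) ≈ Σ (Σ f ∘ g) xs
    Σ-concatMap f g []       = refl
    Σ-concatMap f g (x ∷ xs) = trans (Σ-++ f (g x) _) (+-congˡ (Σ-concatMap f g xs))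

  Σ-upTo-suc : ∀ f n → Σ f (upTo (suc n)) ≈ Σ f (upTo n) + f n
  Σ-upTo-suc f n = begin
    Σ f (upTo (suc n))           ≡⟨ ≡.cong (Σ f) (upTo-∷ʳ n) ⟨
    Σ f (upTo n ++ n ∷ [])       ≈⟨ Σ-++ f (upTo n) _ ⟩
    Σ f (upTo n) + (f n + 0#)    ≈⟨ +-congˡ (+-identityʳ _) ⟩
    Σ f (upTo n) + f n           ∎

  -- The bound `i < n` matters: the weight identities for a descent hold only for letters smaller
  -- than the current one.
  Σ-upTo-cong : ∀ {f g} n → (∀ i → i < n → f i ≈ g i) → Σ f (upTo n) ≈ Σ g (upTo n)
  Σ-upTo-cong         zero    f≈g = refl
  Σ-upTo-cong {f} {g} (suc n) f≈g = begin
    Σ f (upTo (suc n))    ≈⟨ Σ-upTo-suc f n ⟩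
    Σ f (upTo n) + f n    ≈⟨ +-cong (Σ-upTo-cong n (λ i i<n → f≈g i (m<n⇒m<1+n i<n))) (f≈g n (n<1+n n)) ⟩
    Σ g (upTo n) + g n    ≈⟨ Σ-upTo-suc g n ⟨
    Σ g (upTo (suc n))    ∎

-- Commutative ring structure of formal power series.

module PowerSeriesProperties {c ℓ} (R : CommutativeRing c ℓ) where

  open CommutativeRing R
  open RingProperties ring using (+-cancelʳ)
  open CommutativeSemigroupProperties +-commutativeSemigroup using (interchange; x∙yz≈y∙xz)
  open PowerSeries rawRing using (constant; indeterminate; powerSeriesRing) renaming (Series to Ser)
  module S = RawRing powerSeriesRing
  open ≈-Reasoning setoid

  -- By the definition of sum, (f S.* g) (suc n) is f 0 * g (suc n) plus the
  -- n-th coefficient of (f ∘ suc) S.* g; this drives all the inductions.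

  *-cong-≤ : ∀ {f f′ g g′ : Ser} n → (∀ k → k ≤ n → f k ≈ f′ k) →
             (∀ k → k ≤ n → g k ≈ g′ k) → (f S.* g) n ≈ (f′ S.* g′) n
  *-cong-≤ zero    p q = +-congʳ (*-cong (p 0 z≤n) (q 0 z≤n))
  *-cong-≤ (suc n) p q = +-cong (*-cong (p 0 z≤n) (q _ ≤-refl))
    (*-cong-≤ n (λ k k≤n → p _ (s≤s k≤n)) (λ k k≤n → q _ (m≤n⇒m≤1+n k≤n)))

  *-congₛ : ∀ {f f′ g g′ : Ser} → f S.≈ f′ → g S.≈ g′ → f S.* g S.≈ f′ S.* g′
  *-congₛ p q n = *-cong-≤ n (λ k _ → p k) (λ k _ → q k)

  -- The hypothesis is pointwise because shifted constants are literally `λ _ → 0#`, whereas `S.0#`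
  -- is defined by cases on the exponent.
  0-*ₛ : ∀ {f : Ser} → (∀ n → f n ≈ 0#) → ∀ g n → (f S.* g) n ≈ 0#
  0-*ₛ f≈0 g zero    = trans (+-identityʳ _) (trans (*-congʳ (f≈0 0)) (zeroˡ _))
  0-*ₛ f≈0 g (suc n) = begin
    _         ≈⟨ +-cong (trans (*-congʳ (f≈0 0)) (zeroˡ _)) (0-*ₛ (f≈0 ∘ suc) g n) ⟩
    0# + 0#   ≈⟨ +-identityʳ 0# ⟩
    0#        ∎

  constant-* : ∀ a (f : Ser) n → (constant a S.* f) n ≈ a * f n
  constant-* a f zero    = +-identityʳ _
  constant-* a f (suc n) = trans (+-congˡ (0-*ₛ (λ _ → refl) f n)) (+-identityʳ _)

  indeterminate-*-suc : ∀ (f : Ser) n → (indeterminate S.* f) (suc n) ≈ f n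
  indeterminate-*-suc f n = begin
    0# * f (suc n) + ((indeterminate ∘ suc) S.* f) n  ≈⟨ +-cong (zeroˡ _) (*-congₛ {g = f} shift (λ _ → refl) n) ⟩
    0# + (S.1# S.* f) n                               ≈⟨ +-identityˡ _ ⟩
    (S.1# S.* f) n                                    ≈⟨ constant-* 1# f n ⟩
    1# * f n                                          ≈⟨ *-identityˡ _ ⟩
    f n                                               ∎
    where
    shift : ∀ n → indeterminate (suc n) ≈ S.1# n
    shift zero    = refl
    shift (suc n) = refl

  *-distribʳₛ : ∀ (h f g : Ser) → (f S.+ g) S.* h S.≈ f S.* h S.+ g S.* h
  *-distribʳₛ h f g zero    = begin
    (f 0 + g 0) * h 0 + 0#              ≈⟨ +-cong (distribʳ _ _ _) (sym (+-identityʳ 0#)) ⟩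
    f 0 * h 0 + g 0 * h 0 + (0# + 0#)   ≈⟨ interchange _ _ _ _ ⟩
    (f S.* h S.+ g S.* h) 0             ∎
  *-distribʳₛ h f g (suc n) =
    trans (+-cong (distribʳ _ _ _) (*-distribʳₛ h (f ∘ suc) (g ∘ suc) n)) (interchange _ _ _ _)

  -- Serves associativity: shifting `f S.* g` by one leaves the multiple `f 0 * g (suc k)` plus the
  -- product of `f ∘ suc` with `g`.
  scale-* : ∀ a (f g : Ser) n → ((λ k → a * f k) S.* g) n ≈ a * (f S.* g) n
  scale-* a f g zero    = begin
    a * f 0 * g 0 + 0#     ≈⟨ +-identityʳ _ ⟩
    a * f 0 * g 0          ≈⟨ *-assoc _ _ _ ⟩
    a * (f 0 * g 0)        ≈⟨ *-congˡ (+-identityʳ _) ⟨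
    a * (f 0 * g 0 + 0#)   ∎
  scale-* a f g (suc n) =
    trans (+-cong (*-assoc _ _ _) (scale-* a (f ∘ suc) g n)) (sym (distribˡ _ _ _))

  *-assocₛ : ∀ (f g h : Ser) → (f S.* g) S.* h S.≈ f S.* (g S.* h)
  *-assocₛ f g h zero    = begin
    (f 0 * g 0 + 0#) * h 0 + 0#    ≈⟨ +-congʳ (*-congʳ (+-identityʳ _)) ⟩
    f 0 * g 0 * h 0 + 0#           ≈⟨ +-congʳ (*-assoc _ _ _) ⟩
    f 0 * (g 0 * h 0) + 0#         ≈⟨ +-congʳ (*-congˡ (+-identityʳ _)) ⟨
    f 0 * (g 0 * h 0 + 0#) + 0#    ∎
  *-assocₛ f g h (suc n) = begin
    (f 0 * g 0 + 0#) * h (suc n) + (((λ k → f 0 * g (suc k)) S.+ (f ∘ suc) S.* g) S.* h) n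
      ≈⟨ +-cong (trans (*-congʳ (+-identityʳ _)) (*-assoc _ _ _)) (*-distribʳₛ h (λ k → f 0 * g (suc k)) ((f ∘ suc) S.* g) n) ⟩
    f 0 * (g 0 * h (suc n)) + (((λ k → f 0 * g (suc k)) S.* h) n + (((f ∘ suc) S.* g) S.* h) n)
      ≈⟨ +-congˡ (+-cong (scale-* (f 0) (g ∘ suc) h n) (*-assocₛ (f ∘ suc) g h n)) ⟩
    f 0 * (g 0 * h (suc n)) + (f 0 * ((g ∘ suc) S.* h) n + ((f ∘ suc) S.* (g S.* h)) n)
      ≈⟨ +-assoc _ _ _ ⟨
    f 0 * (g 0 * h (suc n)) + f 0 * ((g ∘ suc) S.* h) n + ((f ∘ suc) S.* (g S.* h)) n
      ≈⟨ +-congʳ (distribˡ _ _ _) ⟨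
    f 0 * (g S.* h) (suc n) + ((f ∘ suc) S.* (g S.* h)) n ∎

  -- Mirror image of the defining recursion: it peels the constant term off the second factor, so
  -- that commutativity goes by induction.
  *-sucʳ : ∀ (f g : Ser) n → (f S.* g) (suc n) ≈ f (suc n) * g 0 + (f S.* (g ∘ suc)) n
  *-sucʳ f g zero    = begin
    f 0 * g 1 + (f 1 * g 0 + 0#)   ≈⟨ x∙yz≈y∙xz _ _ _ ⟩
    f 1 * g 0 + (f 0 * g 1 + 0#)   ∎
  *-sucʳ f g (suc n) = begin
    f 0 * g (suc (suc n)) + ((f ∘ suc) S.* g) (suc n)
      ≈⟨ +-congˡ (*-sucʳ (f ∘ suc) g n) ⟩
    f 0 * g (suc (suc n)) + (f (suc (suc n)) * g 0 + ((f ∘ suc) S.* (g ∘ suc)) n)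
      ≈⟨ x∙yz≈y∙xz _ _ _ ⟩
    f (suc (suc n)) * g 0 + (f S.* (g ∘ suc)) (suc n) ∎

  *-commₛ : ∀ (f g : Ser) → f S.* g S.≈ g S.* f
  *-commₛ f g zero    = +-congʳ (*-comm _ _)
  *-commₛ f g (suc n) = begin
    f 0 * g (suc n) + ((f ∘ suc) S.* g) n   ≈⟨ +-cong (*-comm _ _) (*-commₛ (f ∘ suc) g n) ⟩
    g (suc n) * f 0 + (g S.* (f ∘ suc)) n   ≈⟨ *-sucʳ g f n ⟨
    (g S.* f) (suc n)                       ∎

  0#ₛ : ∀ n → S.0# n ≈ 0#
  0#ₛ zero    = refl
  0#ₛ (suc n) = refl

  *-identityˡₛ : ∀ (f : Ser) → S.1# S.* f S.≈ f
  *-identityˡₛ f n = trans (constant-* 1# f n) (*-identityˡ _)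

  isCommutativeRingₛ : IsCommutativeRing S._≈_ S._+_ S._*_ S.-_ S.0# S.1#
  isCommutativeRingₛ = record
    { isRing = record
      { +-isAbelianGroup = record
        { isGroup = record
          { isMonoid = record
            { isSemigroup = record
              { isMagma = record
                { isEquivalence = record
                  { refl  = λ _ → refl
                  ; sym   = λ p n → sym (p n)
                  ; trans = λ p q n → trans (p n) (q n)
                  }
                ; ∙-cong = λ p q n → +-cong (p n) (q n)
                }
              ; assoc = λ f g h n → +-assoc _ _ _
              }
            ; identity = (λ f n → trans (+-congʳ (0#ₛ n)) (+-identityˡ _))
                       , (λ f n → trans (+-congˡ (0#ₛ n)) (+-identityʳ _))
            }
          ; inverse = (λ f n → trans (-‿inverseˡ _) (sym (0#ₛ n)))
                    , (λ f n → trans (-‿inverseʳ _) (sym (0#ₛ n)))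
          ; ⁻¹-cong = λ p n → -‿cong (p n)
          }
        ; comm = λ f g n → +-comm _ _
        }
      ; *-cong = *-congₛ
      ; *-assoc = *-assocₛ
      ; *-identity = *-identityˡₛ
                   , (λ f n → trans (*-commₛ f S.1# n) (*-identityˡₛ f n))
      ; distrib = (λ f g h n → trans (*-commₛ f (g S.+ h) n)
                    (trans (*-distribʳₛ f g h n) (+-cong (*-commₛ g f n) (*-commₛ h f n))))
                , *-distribʳₛ
      }
    ; *-comm = *-commₛ
    }

  powerSeriesCommutativeRing : CommutativeRing c ℓ
  powerSeriesCommutativeRing = record { isCommutativeRing = isCommutativeRingₛ }

  -- Series determined coefficient by coefficient: recurrences and square roots.

  indeterminate-*-zero : ∀ (f : Ser) → (indeterminate S.* f) 0 ≈ 0#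
  indeterminate-*-zero f = trans (+-identityʳ _) (zeroˡ _)

  *-leading : ∀ (f g : Ser) n → (∀ k → k < n → f k ≈ 0#) → (f S.* g) n ≈ f n * g 0
  *-leading f g zero    f≈0 = +-identityʳ _
  *-leading f g (suc n) f≈0 = begin
    f 0 * g (suc n) + ((f ∘ suc) S.* g) n
      ≈⟨ +-cong (trans (*-congʳ (f≈0 0 (s≤s z≤n))) (zeroˡ _))
                (*-leading (f ∘ suc) g n (λ k k<n → f≈0 _ (s≤s k<n))) ⟩
    0# + f (suc n) * g 0   ≈⟨ +-identityˡ _ ⟩
    f (suc n) * g 0        ∎

  module _ {u v : Ser} where

    -- For `u = 1 + x` and `v = y` this is the difference of the equations for `F (a + 1)` and
    -- `F a`, with negative terms moved to the other side.
    Recurrence : (ℕ → Ser) → Set ℓ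
    Recurrence A = ∀ a →
      A (suc a) S.+ indeterminate S.* (u S.* A (suc a)) S.≈
      A a S.+ indeterminate S.* (u S.* A (suc (suc a)) S.+ v S.* A a)

    -- The recurrence looks ahead to A (a + 2), but only behind a factor x, so
    -- one more coefficient of the whole sequence is determined at each stage.
    recurrence-unique : ∀ {A B} → Recurrence A → Recurrence B → A 0 S.≈ B 0 → ∀ a → A a S.≈ B a
    recurrence-unique {A} {B} recA recB A₀≈B₀ a n = below (suc n) a n (n<1+n n)
      where
      below : ∀ n a k → k < n → A a k ≈ B a k
      below (suc n) zero    k       _         = A₀≈B₀ k
      -- Behind the factor x, only coefficients below n of `A (suc a)` and `B (suc a)` enter, and
      -- these agree; so the second summand is common to both sides and cancels.
      below (suc n) (suc a) k k<1+n = +-cancelʳ _ _ _ (begin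
        A (suc a) k + (indeterminate S.* (u S.* A (suc a))) k
          ≈⟨ recA a k ⟩
        A a k + (indeterminate S.* (u S.* A (suc (suc a)) S.+ v S.* A a)) k
          ≈⟨ +-cong (below (suc n) a k k<1+n) (shifted k k<1+n (λ j j<n →
               +-cong (agree u (suc (suc a)) j j<n) (agree v a j j<n))) ⟩
        B a k + (indeterminate S.* (u S.* B (suc (suc a)) S.+ v S.* B a)) k
          ≈⟨ recB a k ⟨
        B (suc a) k + (indeterminate S.* (u S.* B (suc a))) k
          ≈⟨ +-congˡ (shifted k k<1+n (agree u (suc a))) ⟨
        B (suc a) k + (indeterminate S.* (u S.* A (suc a))) k ∎)
        where
        agree : ∀ w b j → j < n → (w S.* A b) j ≈ (w S.* B b) j
        agree w b j j<n = *-cong-≤ {w} {w} {A b} {B b} j (λ _ _ → refl) (λ i i≤j → below n b i (≤-trans (s≤s i≤j) j<n))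
        shifted : ∀ {f g : Ser} k → k < suc n → (∀ j → j < n → f j ≈ g j) →
                  (indeterminate S.* f) k ≈ (indeterminate S.* g) k
        shifted {f} {g} zero    _         _   = trans (indeterminate-*-zero f) (sym (indeterminate-*-zero g))
        shifted {f} {g} (suc k) (s≤s k<n) f≈g = begin
          (indeterminate S.* f) (suc k)   ≈⟨ indeterminate-*-suc f k ⟩
          f k                             ≈⟨ f≈g k k<n ⟩
          g k                             ≈⟨ indeterminate-*-suc g k ⟨
          (indeterminate S.* g) (suc k)   ∎

  -- (s - t) * (s + t) vanishes and its second factor has constant term 2, so
  -- the coefficients of s - t vanish one after the other.
  sqrt-unique : (∀ a → a * (1# + 1#) ≈ 0# → a ≈ 0#) → ∀ {f s t} →
                PowerSeries.IsSqrt rawRing f s → PowerSeries.IsSqrt rawRing f t → s S.≈ t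
  sqrt-unique torsion-free {f} {s} {t} √s √t n = begin
    s n                    ≈⟨ +-identityʳ _ ⟨
    s n + 0#               ≈⟨ +-congˡ (-‿inverseˡ _) ⟨
    s n + (- t n + t n)    ≈⟨ +-assoc _ _ _ ⟨
    d n + t n              ≈⟨ +-congʳ (vanishes (suc n) n (n<1+n n)) ⟩
    0# + t n               ≈⟨ +-identityˡ _ ⟩
    t n                    ∎
    where
    module Ser = CommutativeRing powerSeriesCommutativeRing
    open PowerSeries.IsSqrt
    d e : Ser
    d = s S.+ S.- t
    e = s S.+ t

    s*e≈t*e : s S.* e S.≈ t S.* e
    s*e≈t*e = Ser.trans (Ser.distribˡ s s t) (Ser.trans
      (Ser.+-cong (Ser.trans (square √s) (Ser.sym (square √t))) (Ser.*-comm s t))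
      (Ser.trans (Ser.+-comm (t S.* t) (t S.* s)) (Ser.sym (Ser.distribˡ t s t))))

    d*e≈0 : d S.* e S.≈ S.0#
    d*e≈0 = Ser.trans (RingProperties.[y-z]x≈yx-zx Ser.ring e s t)
      (Ser.trans (Ser.+-congʳ {x = S.- (t S.* e)} s*e≈t*e) (Ser.-‿inverseʳ (t S.* e)))

    vanishes : ∀ n k → k < n → d k ≈ 0#
    vanishes (suc n) k (s≤s k≤n) = torsion-free (d k) (begin
      d k * (1# + 1#)   ≈⟨ *-congˡ (+-cong (constantTerm √s) (constantTerm √t)) ⟨
      d k * e 0         ≈⟨ *-leading d e k (λ j j<k → vanishes n j (≤-trans j<k k≤n)) ⟨
      (d S.* e) k       ≈⟨ d*e≈0 k ⟩
      S.0# k            ≈⟨ 0#ₛ k ⟩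
      0#                ∎)

-- Polynomials as a subring of power series.

module PolynomialProperties {c ℓ} (R : CommutativeRing c ℓ) where

  open CommutativeRing R hiding (zero)
  open RingProperties ring using (-0#≈0#)
  open Polynomial rawRing hiding (indeterminate)
  open PowerSeries rawRing using (powerSeriesRing)
  open PowerSeriesProperties R using (module S; 0-*ₛ; powerSeriesCommutativeRing)

  coeff-+ : ∀ p q n → coeff (p +ₚ q) n ≈ coeff p n + coeff q n
  coeff-+ []      q       n       = sym (+-identityˡ _)
  coeff-+ (a ∷ p) []      n       = sym (+-identityʳ _)
  coeff-+ (a ∷ p) (b ∷ q) zero    = refl
  coeff-+ (a ∷ p) (b ∷ q) (suc n) = coeff-+ p q n

  coeff-map : ∀ {h : Carrier → Carrier} → h 0# ≈ 0# → ∀ p n → coeff (map h p) n ≈ h (coeff p n)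
  coeff-map h0≈0 []      n       = sym h0≈0
  coeff-map h0≈0 (a ∷ p) zero    = refl
  coeff-map h0≈0 (a ∷ p) (suc n) = coeff-map h0≈0 p n

  -- Multiplication of lists follows the same recursion on the first factor as the Cauchy product.
  coeff-* : ∀ p q → coeff (p *ₚ q) S.≈ coeff p S.* coeff q
  coeff-* []      q n = sym (0-*ₛ (λ _ → refl) (coeff q) n)
  coeff-* (a ∷ p) q n = trans (coeff-+ (map (a *_) q) _ n) (head+tail n)
    where
    head+tail : ∀ n → coeff (map (a *_) q) n + coeff (0# ∷ p *ₚ q) n ≈ (coeff (a ∷ p) S.* coeff q) n
    head+tail zero    = +-congʳ (coeff-map (zeroʳ a) q zero)
    head+tail (suc n) = +-cong (coeff-map (zeroʳ a) q (suc n)) (coeff-* p q n)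

  -- Equality of polynomials is equality of coefficients, so injectivity is immediate and the ring
  -- laws can be pulled back from power series.
  coeff-isRingMonomorphism : IsRingMonomorphism polynomialRing powerSeriesRing coeff
  coeff-isRingMonomorphism = record
    { isRingHomomorphism = record
      { isSemiringHomomorphism = record
        { isNearSemiringHomomorphism = record
          { +-isMonoidHomomorphism = record
            { isMagmaHomomorphism = record
              { isRelHomomorphism = record { cong = λ p → p }
              ; homo = coeff-+
              }
            ; ε-homo = λ { zero → refl ; (suc _) → refl }
            }
          ; *-homo = coeff-*
          }
        ; 1#-homo = λ { zero → refl ; (suc _) → refl }
        }
      ; -‿homo = coeff-map -0#≈0#
      }
    ; injective = λ p → p
    }

  polynomialCommutativeRing : CommutativeRing c ℓ
  polynomialCommutativeRing = record
    { isCommutativeRing = RingMonomorphism.isCommutativeRing coeff-isRingMonomorphism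
        (CommutativeRing.isCommutativeRing powerSeriesCommutativeRing)
    }

-- Algebraic elimination in an arbitrary commutative ring.

module Elimination {c ℓ} (R : CommutativeRing c ℓ) where

  open CommutativeRing R
  open RingProperties ring using (+-cancelʳ)
  open RawSemiringDefs (RawRing.rawSemiring rawRing) using (_^_) renaming (_×_ to _·_)
  open NaturalSolver commutativeSemiring using (solve; _:=_; _:+_; _:*_; con)
  open ≈-Reasoning setoid

  -- The solver below handles semirings only, so differences are either opaque atoms for it or
  -- cancelled by hand.
  minus-plus : ∀ a b → a - b + b ≈ a
  minus-plus a b = trans (+-assoc _ _ _) (trans (+-congˡ (-‿inverseˡ b)) (+-identityʳ a))

  minus-swap : ∀ {a b c} → c ≈ a - b → b ≈ a - c
  minus-swap {a} {b} {c} c≈a-b = +-cancelʳ c _ _ (begin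
    b + c          ≈⟨ +-comm b c ⟩
    c + b          ≈⟨ +-congʳ c≈a-b ⟩
    a - b + b      ≈⟨ minus-plus a b ⟩
    a              ≈⟨ minus-plus a c ⟨
    a - c + c      ∎)

  -- Once `T₀` and `T₁` are substituted, the two equations share the terms 1, x and `x * (y * s)`.
  -- Each side of the conclusion adds what the other equation has in excess, so `s` disappears.
  difference : ∀ {x y s F₀ F₁ F₂ T₀ T₁} →
    F₀ ≈ 1# + x * (y * s + T₀ + F₁) → T₀ ≈ 1# + x * F₁ →
    F₁ ≈ 1# + x * (y * (s + F₀) + T₁ + F₂) → T₁ ≈ 1# + x * F₂ →
    F₁ + x * ((1# + x) * F₁) ≈ F₀ + x * ((1# + x) * F₂ + y * F₀)
  difference {x} {y} {s} {F₀} {F₁} {F₂} {T₀} {T₁} eF₀ eT₀ eF₁ eT₁ = begin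
    F₁ + x * ((1# + x) * F₁)
      ≈⟨ +-congʳ (trans eF₁ (+-congˡ (*-congˡ (+-congʳ (+-congˡ eT₁))))) ⟩
    1# + x * (y * (s + F₀) + (1# + x * F₂) + F₂) + x * ((1# + x) * F₁)
      ≈⟨ solve 6 (λ x y s F₀ F₁ F₂ →
           con 1 :+ x :* (y :* (s :+ F₀) :+ (con 1 :+ x :* F₂) :+ F₂) :+ x :* ((con 1 :+ x) :* F₁) :=
           con 1 :+ x :* (y :* s :+ (con 1 :+ x :* F₁) :+ F₁) :+ x :* ((con 1 :+ x) :* F₂ :+ y :* F₀))
           refl x y s F₀ F₁ F₂ ⟩
    1# + x * (y * s + (1# + x * F₁) + F₁) + x * ((1# + x) * F₂ + y * F₀)
      ≈⟨ +-congʳ (trans eF₀ (+-congˡ (*-congˡ (+-congʳ (+-congˡ eT₀))))) ⟨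
    F₀ + x * ((1# + x) * F₂ + y * F₀) ∎

  -- The recurrence is linear and homogeneous, so multiples of a solution by a fixed series are
  -- again solutions.
  scaleʳ : ∀ {x y F₀ F₁ F₂} c →
    F₁ + x * ((1# + x) * F₁) ≈ F₀ + x * ((1# + x) * F₂ + y * F₀) →
    c * F₁ + x * ((1# + x) * (c * F₁)) ≈ c * F₀ + x * ((1# + x) * (c * F₂) + y * (c * F₀))
  scaleʳ {x} {y} {F₀} {F₁} {F₂} c e = begin
    c * F₁ + x * ((1# + x) * (c * F₁))
      ≈⟨ solve 3 (λ x c F₁ → c :* F₁ :+ x :* ((con 1 :+ x) :* (c :* F₁)) :=
           c :* (F₁ :+ x :* ((con 1 :+ x) :* F₁))) refl x c F₁ ⟩
    c * (F₁ + x * ((1# + x) * F₁))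
      ≈⟨ *-congˡ e ⟩
    c * (F₀ + x * ((1# + x) * F₂ + y * F₀))
      ≈⟨ solve 5 (λ x y c F₀ F₂ → c :* (F₀ :+ x :* ((con 1 :+ x) :* F₂ :+ y :* F₀)) :=
           c :* F₀ :+ x :* ((con 1 :+ x) :* (c :* F₂) :+ y :* (c :* F₀))) refl x y c F₀ F₂ ⟩
    c * F₀ + x * ((1# + x) * (c * F₂) + y * (c * F₀)) ∎

  -- Multiply the recurrence by F₀, replace F₀ * F₂ by F₁ * F₁, and eliminate
  -- the remaining factors x * (1# + x) * F₁ by means of the equation for F₀.
  quadratic : ∀ {x y F₀ F₁ F₂} →
    F₀ ≈ 1# + x + x * ((1# + x) * F₁) →
    F₁ + x * ((1# + x) * F₁) ≈ F₀ + x * ((1# + x) * F₂ + y * F₀) →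
    F₁ * F₁ ≈ F₀ * F₂ →
    F₀ ≈ 1# + x + x * ((1# + x) * F₀) + x * (x * (y * (F₀ * F₀)))
  quadratic {x} {y} {F₀} {F₁} {F₂} eF₀ rec geometric = begin
    F₀                               ≈⟨ eF₀ ⟩
    1# + x + x * ((1# + x) * F₁)     ≈⟨ +-congˡ (*-congˡ linear) ⟩
    1# + x + x * ((1# + x) * F₀ + x * (y * (F₀ * F₀)))
      ≈⟨ solve 3 (λ x y F₀ →
           con 1 :+ x :+ x :* ((con 1 :+ x) :* F₀ :+ x :* (y :* (F₀ :* F₀))) :=
           con 1 :+ x :+ x :* ((con 1 :+ x) :* F₀) :+ x :* (x :* (y :* (F₀ :* F₀)))) refl x y F₀ ⟩
    1# + x + x * ((1# + x) * F₀) + x * (x * (y * (F₀ * F₀))) ∎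
    where
    linear : (1# + x) * F₁ ≈ (1# + x) * F₀ + x * (y * (F₀ * F₀))
    -- Expanding one factor of `F₀ * F₀` by `eF₀` completes `F₀` times the left side of `rec`. At
    -- the end, `F₁` times the right side of `eF₀` folds back into `F₀ * F₁`.
    linear = +-cancelʳ (F₀ * F₁ + F₀ * F₀) _ _ (begin
      (1# + x) * F₁ + (F₀ * F₁ + F₀ * F₀)
        ≈⟨ +-congˡ (+-congˡ (*-congˡ eF₀)) ⟩
      (1# + x) * F₁ + (F₀ * F₁ + F₀ * (1# + x + x * ((1# + x) * F₁)))
        ≈⟨ solve 3 (λ x F₀ F₁ →
             (con 1 :+ x) :* F₁ :+ (F₀ :* F₁ :+ F₀ :* (con 1 :+ x :+ x :* ((con 1 :+ x) :* F₁))) :=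
             F₀ :* (F₁ :+ x :* ((con 1 :+ x) :* F₁)) :+ (con 1 :+ x) :* (F₀ :+ F₁)) refl x F₀ F₁ ⟩
      F₀ * (F₁ + x * ((1# + x) * F₁)) + (1# + x) * (F₀ + F₁)
        ≈⟨ +-congʳ (*-congˡ rec) ⟩
      F₀ * (F₀ + x * ((1# + x) * F₂ + y * F₀)) + (1# + x) * (F₀ + F₁)
        ≈⟨ solve 5 (λ x y F₀ F₁ F₂ →
             F₀ :* (F₀ :+ x :* ((con 1 :+ x) :* F₂ :+ y :* F₀)) :+ (con 1 :+ x) :* (F₀ :+ F₁) :=
             (F₀ :* F₀ :+ x :* (y :* (F₀ :* F₀)) :+ (con 1 :+ x) :* (F₀ :+ F₁)) :+ x :* ((con 1 :+ x) :* (F₀ :* F₂)))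
             refl x y F₀ F₁ F₂ ⟩
      (F₀ * F₀ + x * (y * (F₀ * F₀)) + (1# + x) * (F₀ + F₁)) + x * ((1# + x) * (F₀ * F₂))
        ≈⟨ +-congˡ (*-congˡ (*-congˡ geometric)) ⟨
      (F₀ * F₀ + x * (y * (F₀ * F₀)) + (1# + x) * (F₀ + F₁)) + x * ((1# + x) * (F₁ * F₁))
        ≈⟨ solve 4 (λ x y F₀ F₁ →
             (F₀ :* F₀ :+ x :* (y :* (F₀ :* F₀)) :+ (con 1 :+ x) :* (F₀ :+ F₁)) :+ x :* ((con 1 :+ x) :* (F₁ :* F₁)) :=
             (con 1 :+ x) :* F₀ :+ x :* (y :* (F₀ :* F₀)) :+ (F₁ :* (con 1 :+ x :+ x :* ((con 1 :+ x) :* F₁)) :+ F₀ :* F₀))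
             refl x y F₀ F₁ ⟩
      (1# + x) * F₀ + x * (y * (F₀ * F₀)) + (F₁ * (1# + x + x * ((1# + x) * F₁)) + F₀ * F₀)
        ≈⟨ +-congˡ (+-congʳ (trans (*-congˡ (sym eF₀)) (*-comm _ _))) ⟩
      (1# + x) * F₀ + x * (y * (F₀ * F₀)) + (F₀ * F₁ + F₀ * F₀) ∎)

  functional-equation : ∀ {x y F C} →
    F ≈ 1# + x + x * ((1# + x) * F) + x * (x * (y * (F * F))) →
    C ≈ 1# + x * F →
    x * y * (C * C) + (1# + x * y) + (x + x * x) * C ≈ C + 2 · (x * y) * C
  functional-equation {x} {y} {F} {C} eF eC = begin
    x * y * (C * C) + (1# + x * y) + (x + x * x) * C
      ≈⟨ +-cong (+-congʳ (*-congˡ (*-cong eC eC))) (*-congˡ eC) ⟩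
    x * y * ((1# + x * F) * (1# + x * F)) + (1# + x * y) + (x + x * x) * (1# + x * F)
      -- The multiple `2 · z` unfolds to `z + (z + 0#)`, hence the `con 0`.
      ≈⟨ solve 3 (λ x y F →
           x :* y :* ((con 1 :+ x :* F) :* (con 1 :+ x :* F)) :+ (con 1 :+ x :* y) :+ (x :+ x :* x) :* (con 1 :+ x :* F) :=
           con 1 :+ x :* (con 1 :+ x :+ x :* ((con 1 :+ x) :* F) :+ x :* (x :* (y :* (F :* F))))
             :+ (x :* y :+ (x :* y :+ con 0)) :* (con 1 :+ x :* F))
           refl x y F ⟩
    1# + x * (1# + x + x * ((1# + x) * F) + x * (x * (y * (F * F)))) + 2 · (x * y) * (1# + x * F)
      ≈⟨ +-cong (trans eC (+-congˡ (*-congˡ eF))) (*-congˡ eC) ⟨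
    C + 2 · (x * y) * C ∎

  -- With P = S + 2zC, one has P² = S² + 4z(SC + zC²). The functional equation reads PC = zC² + 1 +
  -- z, so SC + zC² = PC - zC² = 1 + z.
  square-discriminant : ∀ {x z C} → let P = 1# - x - x ^ 2 + 2 · z in
    z * (C * C) + (1# + z) + (x + x * x) * C ≈ C + 2 · z * C →
    (P - 2 · z * C) * (P - 2 · z * C) ≈ P ^ 2 - 4 · z * (1# + z)
  square-discriminant {x} {z} {C} functional = begin
    S * S                  ≈⟨ +-identityʳ _ ⟨
    S * S + 0#             ≈⟨ +-congˡ (-‿inverseʳ W) ⟨
    S * S + (W - W)        ≈⟨ +-assoc _ _ _ ⟨
    S * S + W - W          ≈⟨ +-congʳ P²≈S²+W ⟨
    P ^ 2 - W              ∎
    where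
    P = 1# - x - x ^ 2 + 2 · z
    S = P - 2 · z * C
    W = 4 · z * (1# + z)

    P≈S+2zC : P ≈ S + 2 · z * C
    P≈S+2zC = sym (minus-plus P (2 · z * C))

    P+x+x² : P + (x + x * x) ≈ 1# + 2 · z
    P+x+x² = begin
      1# - x - x ^ 2 + 2 · z + (x + x * x)
        ≈⟨ solve 4 (λ a b x z → a :+ b :+ z :+ (x :+ x :* x) := a :+ b :+ x :* (x :* con 1) :+ (x :+ z))
             refl (1# - x) (- x ^ 2) x (2 · z) ⟩
      1# - x - x ^ 2 + x ^ 2 + (x + 2 · z)
        ≈⟨ +-congʳ (minus-plus _ _) ⟩
      1# - x + (x + 2 · z)
        ≈⟨ +-assoc _ _ _ ⟨
      1# - x + x + 2 · z
        ≈⟨ +-congʳ (minus-plus _ _) ⟩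
      1# + 2 · z ∎

    PC : P * C ≈ z * (C * C) + (1# + z)
    PC = +-cancelʳ ((x + x * x) * C) _ _ (begin
      P * C + (x + x * x) * C                     ≈⟨ distribʳ _ _ _ ⟨
      (P + (x + x * x)) * C                       ≈⟨ *-congʳ P+x+x² ⟩
      (1# + 2 · z) * C                            ≈⟨ distribʳ _ _ _ ⟩
      1# * C + 2 · z * C                          ≈⟨ +-congʳ (*-identityˡ _) ⟩
      C + 2 · z * C                               ≈⟨ functional ⟨
      z * (C * C) + (1# + z) + (x + x * x) * C    ∎)

    SC : S * C + z * (C * C) ≈ 1# + z
    SC = +-cancelʳ (z * (C * C)) _ _ (begin
      S * C + z * (C * C) + z * (C * C)
        ≈⟨ solve 3 (λ S z C → S :* C :+ z :* (C :* C) :+ z :* (C :* C) :=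
             (S :+ (z :+ (z :+ con 0)) :* C) :* C) refl S z C ⟩
      (S + 2 · z * C) * C          ≈⟨ *-congʳ P≈S+2zC ⟨
      P * C                        ≈⟨ PC ⟩
      z * (C * C) + (1# + z)       ≈⟨ +-comm _ _ ⟩
      1# + z + z * (C * C)         ∎)

    P²≈S²+W : P ^ 2 ≈ S * S + W
    P²≈S²+W = begin
      P * (P * 1#)
        ≈⟨ *-congˡ (*-identityʳ P) ⟩
      P * P
        ≈⟨ *-cong P≈S+2zC P≈S+2zC ⟩
      (S + 2 · z * C) * (S + 2 · z * C)
        ≈⟨ solve 3 (λ S z C →
             (S :+ (z :+ (z :+ con 0)) :* C) :* (S :+ (z :+ (z :+ con 0)) :* C) :=
             S :* S :+ (z :+ (z :+ (z :+ (z :+ con 0)))) :* (S :* C :+ z :* (C :* C)))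
             refl S z C ⟩
      S * S + 4 · z * (S * C + z * (C * C))
        ≈⟨ +-congˡ (*-congˡ SC) ⟩
      S * S + W ∎

-- Counting avoiding words by their first letters.

module AvoidingWords {c ℓ} (R : CommutativeRing c ℓ) (q : CommutativeRing.Carrier R) where

  open CommutativeRing R hiding (zero)
  open RawSemiringDefs (RawRing.rawSemiring rawRing) using (_^_)
  open PowerSeries rawRing using (constant; indeterminate) renaming (Series to Ser)
  open PowerSeriesProperties R
  open ListSum R

  -- Avoidance is built into the weight, so that sums can run over all continuations, which have a
  -- simple recursive structure.
  weight : List ℕ → Carrier
  weight w = if does (avoids? _≟_ _≥?_ w) then q ^ des w else 0#

  -- An occurrence starting at the first letter would require `a ≡ b`; the ascent adds no descent
  -- either.
  weight-ascent : ∀ {a b} → a < b → ∀ u → weight (a ∷ b ∷ u) ≡ weight (b ∷ u)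
  weight-ascent {a} {b} a<b [] rewrite dec-false (a >? b) (<⇒≯ a<b) = ≡.refl
  weight-ascent {a} {b} a<b (c ∷ u)
    rewrite dec-false (a ≟ b) (<⇒≢ a<b) | dec-false (a >? b) (<⇒≯ a<b) = ≡.refl

  weight-descent : ∀ {a b} → b < a → ∀ u → weight (a ∷ b ∷ u) ≈ q * weight (b ∷ u)
  weight-descent {a} {b} b<a [] rewrite dec-true (a >? b) b<a = refl
  weight-descent {a} {b} b<a (c ∷ u)
    rewrite dec-false (a ≟ b) (>⇒≢ b<a) | dec-true (a >? b) b<a
    with does (avoids? _≟_ _≥?_ (b ∷ c ∷ u))
  ... | true  = refl
  ... | false = sym (zeroʳ q)

  -- The ascent violates the second relation at the level, and then `weight-ascent` removes the
  -- remaining `a`.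
  weight-level-ascent : ∀ {a b} → a < b → ∀ u → weight (a ∷ a ∷ b ∷ u) ≡ weight (b ∷ u)
  weight-level-ascent {a} {b} a<b u
    rewrite dec-true (a ≟ a) ≡.refl | dec-false (a ≥? b) (<⇒≱ a<b)
          | dec-false (a >? a) (<-irrefl ≡.refl) = weight-ascent a<b u

  weight-level-weak-descent : ∀ {a b} → b ≤ a → ∀ u → weight (a ∷ a ∷ b ∷ u) ≡ 0#
  weight-level-weak-descent {a} {b} b≤a u
    rewrite dec-true (a ≟ a) ≡.refl | dec-true (a ≥? b) b≤a = ≡.refl

  -- `T` covers the state after a repeated letter, where the next letter must ascend. The letter `a`
  -- stays inside the weighted word because its comparison with the next letter decides descents and
  -- occurrences.
  F T below : ℕ → Ser
  F a n = Σ (λ u → weight (a ∷ u)) (continuations a n)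
  T a n = Σ (λ u → weight (a ∷ a ∷ u)) (continuations a n)
  below a n = Σ (λ b → F b n) (upTo a)

  -- The next letter is at most `suc a`; the three summands are the descents, the level and the
  -- ascent.
  Σ-continuations : ∀ h a n → Σ h (continuations a (suc n)) ≈
    Σ (λ b → Σ (h ∘ (b ∷_)) (continuations b n)) (upTo a)
      + Σ (h ∘ (a ∷_)) (continuations a n) + Σ (h ∘ (suc a ∷_)) (continuations (suc a) n)
  Σ-continuations h a n = begin
    Σ h (continuations a (suc n))
      ≈⟨ Σ-concatMap h (λ b → map (b ∷_) (continuations b n)) (upTo (suc (suc a))) ⟩
    Σ (λ b → Σ h (map (b ∷_) (continuations b n))) (upTo (suc (suc a)))
      ≈⟨ Σ-cong (λ b → Σ-map h (b ∷_) (continuations b n)) (upTo (suc (suc a))) ⟩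
    Σ G (upTo (suc (suc a)))
      ≈⟨ trans (Σ-upTo-suc G (suc a)) (+-congʳ (Σ-upTo-suc G a)) ⟩
    Σ G (upTo a) + G a + G (suc a) ∎
    where
    open ≈-Reasoning setoid
    G : ℕ → Carrier
    G b = Σ (h ∘ (b ∷_)) (continuations b n)

  F-suc : ∀ a n → F a (suc n) ≈ q * below a n + T a n + F (suc a) n
  F-suc a n = trans (Σ-continuations (λ u → weight (a ∷ u)) a n)
    (+-cong (+-congʳ descents) (Σ-cong (λ u → reflexive (weight-ascent (n<1+n a) u)) (continuations (suc a) n)))
    where
    descents : Σ (λ b → Σ (λ u → weight (a ∷ b ∷ u)) (continuations b n)) (upTo a) ≈ q * below a n
    descents = trans
      (Σ-upTo-cong a λ b b<a → trans (Σ-cong (weight-descent b<a) (continuations b n)) (Σ-distribˡ q _ (continuations b n)))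
      (Σ-distribˡ q (λ b → F b n) (upTo a))

  -- After a level, a further level or a descent completes the pattern, so only the ascent to
  -- `suc a` survives.
  T-suc : ∀ a n → T a (suc n) ≈ F (suc a) n
  T-suc a n = begin
    T a (suc n)
      ≈⟨ Σ-continuations (λ u → weight (a ∷ a ∷ u)) a n ⟩
    Σ (λ b → Σ (λ u → weight (a ∷ a ∷ b ∷ u)) (continuations b n)) (upTo a)
      + Σ (λ u → weight (a ∷ a ∷ a ∷ u)) (continuations a n)
      + Σ (λ u → weight (a ∷ a ∷ suc a ∷ u)) (continuations (suc a) n)
      ≈⟨ +-cong (+-cong
           (trans (Σ-upTo-cong a λ b b<a → vanish b (<⇒≤ b<a)) (Σ-zero (λ _ → refl) (upTo a)))
           (vanish a ≤-refl))
           (Σ-cong (λ u → reflexive (weight-level-ascent (n<1+n a) u)) (continuations (suc a) n)) ⟩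
    0# + 0# + F (suc a) n   ≈⟨ +-congʳ (+-identityʳ 0#) ⟩
    0# + F (suc a) n        ≈⟨ +-identityˡ _ ⟩
    F (suc a) n             ∎
    where
    open ≈-Reasoning setoid
    vanish : ∀ b → b ≤ a → Σ (λ u → weight (a ∷ a ∷ b ∷ u)) (continuations b n) ≈ 0#
    vanish b b≤a = Σ-zero (λ u → reflexive (weight-level-weak-descent b≤a u)) (continuations b n)

  -- From coefficient recursions to equations between series.

  1+indeterminate* : ∀ {f g : Ser} → f 0 ≈ 1# → (∀ n → f (suc n) ≈ g n) →
                     f S.≈ S.1# S.+ indeterminate S.* g
  1+indeterminate* {f} {g} f₀ fₛ zero    =
    trans f₀ (sym (trans (+-congˡ (indeterminate-*-zero g)) (+-identityʳ _)))
  1+indeterminate* {f} {g} f₀ fₛ (suc n) =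
    trans (fₛ n) (sym (trans (+-congˡ (indeterminate-*-suc g n)) (+-identityˡ _)))

  x y : Ser
  x = indeterminate
  y = constant q

  F-equation : ∀ a → F a S.≈ S.1# S.+ x S.* (y S.* below a S.+ T a S.+ F (suc a))
  F-equation a = 1+indeterminate* (+-identityʳ _)
    (λ n → trans (F-suc a n) (+-congʳ (+-congʳ (sym (constant-* q (below a) n)))))

  T-equation : ∀ a → T a S.≈ S.1# S.+ x S.* F (suc a)
  T-equation a = 1+indeterminate* (trans (+-identityʳ _) (reflexive (T₀ a))) (T-suc a)
    where
    T₀ : ∀ a → weight (a ∷ a ∷ []) ≡ 1#
    T₀ a rewrite dec-false (a >? a) (<-irrefl ≡.refl) = ≡.refl

  -- Over ℤ[y], with `q` the indeterminate, this unfolds to `C _≟_ _≥?_`.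
  generatingFunction : Ser
  generatingFunction n = Σ (λ w → q ^ des w) (filter (avoids? _≟_ _≥?_) (catalanWords n))

  -- A nonempty Catalan word starts with 0, which has no predecessor to repeat; its tail is thus
  -- counted by `F 0`.
  generatingFunction-equation : generatingFunction S.≈ S.1# S.+ x S.* F 0
  generatingFunction-equation = 1+indeterminate* (+-identityʳ _) (λ n →
    trans (Σ-filter (avoids? _≟_ _≥?_) _ (catalanWords (suc n))) (Σ-map weight (0 ∷_) (continuations 0 n)))

  private module Ser = CommutativeRing powerSeriesCommutativeRing
  open Elimination powerSeriesCommutativeRing

  F-recurrence : Recurrence {S.1# S.+ x} {y} F
  F-recurrence a = difference {x} {y} {below a} (F-equation a) (T-equation a)
    (Ser.trans (F-equation (suc a))
      (Ser.+-congˡ {S.1#} (Ser.*-congˡ {x} (Ser.+-congʳ {F (suc (suc a))} (Ser.+-congʳ {T (suc a)}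
        (Ser.*-congˡ {y} (λ n → Σ-upTo-suc (λ b → F b n) a)))))))
    (T-equation (suc a))

  -- Both sides satisfy the recurrence of F and agree at a = 0, so F is a
  -- geometric progression.
  F-geometric : ∀ a → F 1 S.* F a S.≈ F 0 S.* F (suc a)
  F-geometric = recurrence-unique {S.1# S.+ x} {y}
    (λ a → scaleʳ {x} {y} (F 1) (F-recurrence a))
    (λ a → scaleʳ {x} {y} (F 0) (F-recurrence (suc a)))
    (Ser.*-comm (F 1) (F 0))

  F₀-equation : F 0 S.≈ S.1# S.+ x S.+ x S.* ((S.1# S.+ x) S.* F 1)
  F₀-equation = begin
    F 0
      ≈⟨ F-equation 0 ⟩
    S.1# S.+ x S.* (y S.* below 0 S.+ T 0 S.+ F 1)
      ≈⟨ Ser.+-congˡ {S.1#} (Ser.*-congˡ {x} (Ser.+-congʳ {F 1} (Ser.+-cong {x = y S.* below 0} y*below₀ (T-equation 0)))) ⟩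
    S.1# S.+ x S.* (S.0# S.+ (S.1# S.+ x S.* F 1) S.+ F 1)
      ≈⟨ solve 2 (λ x F → con 1 :+ x :* (con 0 :+ (con 1 :+ x :* F) :+ F) :=
           con 1 :+ x :+ x :* ((con 1 :+ x) :* F)) Ser.refl x (F 1) ⟩
    S.1# S.+ x S.+ x S.* ((S.1# S.+ x) S.* F 1) ∎
    where
    open ≈-Reasoning Ser.setoid
    open NaturalSolver Ser.commutativeSemiring using (solve; _:=_; _:+_; _:*_; con)
    y*below₀ : y S.* below 0 S.≈ S.0#
    y*below₀ n = trans (constant-* q (below 0) n) (trans (zeroʳ q) (sym (0#ₛ n)))

  generatingFunction-functional-equation :
    let C = generatingFunction in
    x S.* y S.* (C S.* C) S.+ (S.1# S.+ x S.* y) S.+ (x S.+ x S.* x) S.* C S.≈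
    C S.+ (x S.* y S.+ (x S.* y S.+ S.0#)) S.* C
  generatingFunction-functional-equation = functional-equation {x} {y} {F 0}
    (quadratic {x} {y} F₀-equation (F-recurrence 0) (F-geometric 1))
    generatingFunction-equation

-- Specialisation to ℤ[y] and the closed form.

open import Defs

ℤ[y]-commutativeRing : CommutativeRing _ _
ℤ[y]-commutativeRing = PolynomialProperties.polynomialCommutativeRing ℤ.+-*-commutativeRing

ℤ[y]-torsion-free : let module R = CommutativeRing ℤ[y]-commutativeRing in
                    ∀ p → p R.* (R.1# R.+ R.1#) R.≈ R.0# → p R.≈ R.0#
ℤ[y]-torsion-free p 2p≈0 n = i+i≡0⇒i≡0 (begin
  coeff p n ℤ.+ coeff p n                       ≡⟨ ≡.cong₂ ℤ._+_ (R.*-identityʳ p n) (R.*-identityʳ p n) ⟨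
  coeff (p R.* R.1#) n ℤ.+ coeff (p R.* R.1#) n ≡⟨ coeff-+ (p R.* R.1#) (p R.* R.1#) n ⟨
  coeff (p R.* R.1# R.+ p R.* R.1#) n           ≡⟨ R.distribˡ p R.1# R.1# n ⟨
  coeff (p R.* (R.1# R.+ R.1#)) n               ≡⟨ 2p≈0 n ⟩
  ℤ.0ℤ                                          ∎)
  where
  module R = CommutativeRing ℤ[y]-commutativeRing
  open PolynomialProperties ℤ.+-*-commutativeRing using (coeff-+)
  open Polynomial ℤ.+-*-rawRing using (coeff)
  open ≡.≡-Reasoning
  i+i≡0⇒i≡0 : ∀ {i} → i ℤ.+ i ≡ ℤ.0ℤ → i ≡ ℤ.0ℤ
  -- For every other integer the sum computes to a visibly nonzero constructor form, which rules the
  -- case out.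
  i+i≡0⇒i≡0 {ℤ.+ zero} _ = ≡.refl

theorem3p1 :
    let P = 1# - x - x ^ 2 + 2 · (x * y)
        D = P ^ 2 - 4 · (x * y) * (1# + x * y)
    in (∃ λ S → IsSqrt D S) × (∀ S → IsSqrt D S → 2 · (x * y) * C _≟_ _≥?_ ≈ P - S)
-- Any root `S` equals `S₀`, that is `P` minus the wanted multiple of the generating function;
-- swapping the two subtracted terms isolates that multiple.
theorem3p1 = (S₀ , √S₀) , λ S √S → minus-swap {P} {2 · (x * y) * C _≟_ _≥?_} {S} (sqrt-unique ℤ[y]-torsion-free √S √S₀)
  where
  open PowerSeriesProperties ℤ[y]-commutativeRing using (powerSeriesCommutativeRing; sqrt-unique)
  open Elimination powerSeriesCommutativeRing using (minus-swap; square-discriminant)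
  open AvoidingWords ℤ[y]-commutativeRing (Polynomial.indeterminate ℤ.+-*-rawRing)
    using (generatingFunction-functional-equation)
  P S₀ : Series
  P = 1# - x - x ^ 2 + 2 · (x * y)
  S₀ = P - 2 · (x * y) * C _≟_ _≥?_
  √S₀ : IsSqrt (P ^ 2 - 4 · (x * y) * (1# + x * y)) S₀
  √S₀ = record
    -- All terms of `S₀` except `1#` carry a factor `x`, and `x 0` is the empty list, so they vanish
    -- by computation.
    { constantTerm = λ { zero → ≡.refl ; (suc n) → ≡.refl }
    ; square       = square-discriminant {x} {x * y} {C _≟_ _≥?_} generatingFunction-functional-equation
    }
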